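{- Let $\Delta$ be a simplicial complex on vertex set $[n]$. If $\Delta$ is skeleton-E-chordal, then its Alexander dual $\Delta^\vee$ is vertex-decomposable. The converse is false, already for $\dim(\Delta^\vee)=1$: there is a simplicial complex $\Delta$ such that $\Delta^\vee$ is $1$-dimensional and vertex-decomposable, but $\Delta$ is not skeleton-E-chordal.
   Context: Simplicial complexes are finite and not necessarily pure. A vertex labeling of a complex with $n$ vertices is a bijection of its vertices with $[n]$; $\max f$ is the largest label in $f$; the size of a face is its number of vertices. $\Delta$ is skeleton-E-chordal if it has a vertex labeling such that for every two faces $f\neq g$ of $\Delta$ with the same size and the same maximum, every subset $h\subseteq f\cup g$ with $|h|=|f|$ is a face of $\Delta$. The Alexander dual of $\Delta$ on vertex set $[n]$ is $\Delta^\vee=\{F\subseteq[n] : [n]\setminus F\notin\Delta\}$. A vertex $v$ of a complex $\Gamma$ is shedding if no facet of $\operatorname{link}(v,\Gamma)$ is also a facet of $\operatorname{del}(v,\Gamma)$, where $\operatorname{del}(v,\Gamma)$ is the subcomplex of all faces not containing $v$. A (not necessarily pure) complex $\Gamma$ is vertex-decomposable if it is a simplex, or $\Gamma=\{\emptyset\}$, or $\Gamma=\emptyset$, or (recursively) it has a shedding vertex $v$ such that $\operatorname{del}(v,\Gamma)$ and $\operatorname{link}(v,\Gamma)$ are both vertex-decomposable. -}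

module Defs where

open import Data.Fin.Base using (Fin) renaming (_≤_ to _≤ᶠ_)
open import Data.Fin.Permutation using (Permutation′; _⟨$⟩ʳ_)
open import Data.Fin.Subset using (Subset; ⊥; ⁅_⁆; _∈_; _∉_; _⊆_; _∪_; ∁; ∣_∣)
open import Data.Fin.Subset.Properties
  using (_∈?_; p⊆p∪q; q⊆p∪q; x∈p∪q⁻; x∈∁p⇒x∉p; x∉p⇒x∈∁p)
open import Data.Nat.Base using (ℕ; suc; _≤_)
open import Data.Product.Base using (Σ-syntax; ∃-syntax; _×_; _,_)
open import Data.Sum.Base using (inj₁; inj₂)
open import Function.Base using (_∘_)
open import Function.Bundles using (_⇔_)
open import Level using (0ℓ)
open import Relation.Binary.PropositionalEquality.Core using (_≡_; _≢_)
open import Relation.Nullary using (¬_)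
open import Relation.Nullary.Decidable using (¬?; _×-dec_)
open import Relation.Unary using (Pred; Decidable)

private
  variable
    n : ℕ

-- The void complex (no faces, not even ∅) is allowed, and a singleton ⁅ i ⁆
-- need not be a face: both occur for Alexander duals, links and deletions,
-- all of which are kept on the ground set Fin n.
record SimplicialComplex (n : ℕ) : Set₁ where
  field
    Face        : Pred (Subset n) 0ℓ
    face?       : Decidable Face
    down-closed : ∀ {F G} → G ⊆ F → Face F → Face G

open SimplicialComplex public

IsVertex : SimplicialComplex n → Fin n → Set
IsVertex Γ v = Face Γ ⁅ v ⁆

IsFacet : SimplicialComplex n → Subset n → Set
IsFacet Γ F = Face Γ F × (∀ G → Face Γ G → F ⊆ G → F ≡ G)

HasDimension : SimplicialComplex n → ℕ → Set
HasDimension Γ d =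
  (∃[ F ] Face Γ F × ∣ F ∣ ≡ suc d) × (∀ F → Face Γ F → ∣ F ∣ ≤ suc d)

-- Elements i with ⁅ i ⁆ not a face are labeled as well; they lie in no face,
-- so only the relative order of the labels of the actual vertices is ever used.
VertexLabeling : ℕ → Set
VertexLabeling n = Permutation′ n

IsMaxLabel : VertexLabeling n → Subset n → Fin n → Set
IsMaxLabel ℓ f m =
  (∃[ i ] i ∈ f × ℓ ⟨$⟩ʳ i ≡ m) × (∀ i → i ∈ f → (ℓ ⟨$⟩ʳ i) ≤ᶠ m)

-- Two distinct faces of the same size are nonempty, so the relational form
-- excludes nothing that a total function max would allow.
SameMax : VertexLabeling n → Subset n → Subset n → Set
SameMax ℓ f g = ∃[ m ] IsMaxLabel ℓ f m × IsMaxLabel ℓ g m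

SkeletonEChordal : SimplicialComplex n → Set
SkeletonEChordal {n} Δ = Σ[ ℓ ∈ VertexLabeling n ]
  (∀ f g → Face Δ f → Face Δ g → f ≢ g → ∣ f ∣ ≡ ∣ g ∣ → SameMax ℓ f g →
   ∀ h → h ⊆ f ∪ g → ∣ h ∣ ≡ ∣ f ∣ → Face Δ h)

infix 9 _ᵛ

_ᵛ : SimplicialComplex n → SimplicialComplex n
Face        (Δ ᵛ) F = ¬ Face Δ (∁ F)
face?       (Δ ᵛ) F = ¬? (face? Δ (∁ F))
down-closed (Δ ᵛ) G⊆F ∁F∉Δ ∁G∈Δ =
  ∁F∉Δ (down-closed Δ (λ x∈∁F → x∉p⇒x∈∁p (x∈∁p⇒x∉p x∈∁F ∘ G⊆F)) ∁G∈Δ)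

del : Fin n → SimplicialComplex n → SimplicialComplex n
Face        (del v Γ) F = v ∉ F × Face Γ F
face?       (del v Γ) F = ¬? (v ∈? F) ×-dec face? Γ F
down-closed (del v Γ) G⊆F (v∉F , F∈Γ) = v∉F ∘ G⊆F , down-closed Γ G⊆F F∈Γ

link : Fin n → SimplicialComplex n → SimplicialComplex n
Face        (link v Γ) F = v ∉ F × Face Γ (F ∪ ⁅ v ⁆)
face?       (link v Γ) F = ¬? (v ∈? F) ×-dec face? Γ (F ∪ ⁅ v ⁆)
down-closed (link v Γ) {F} {G} G⊆F (v∉F , Fv∈Γ) = v∉F ∘ G⊆F , down-closed Γ Gv⊆Fv Fv∈Γ
  where
  Gv⊆Fv : G ∪ ⁅ v ⁆ ⊆ F ∪ ⁅ v ⁆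
  Gv⊆Fv x∈Gv with x∈p∪q⁻ G ⁅ v ⁆ x∈Gv
  ... | inj₁ x∈G = p⊆p∪q ⁅ v ⁆ (G⊆F x∈G)
  ... | inj₂ x∈v = q⊆p∪q F ⁅ v ⁆ x∈v

IsShedding : SimplicialComplex n → Fin n → Set
IsShedding Γ v =
  IsVertex Γ v × (∀ F → IsFacet (link v Γ) F → ¬ IsFacet (del v Γ) F)

IsSimplex : SimplicialComplex n → Set
IsSimplex Γ = ∃[ S ] (∀ F → Face Γ F ⇔ F ⊆ S)

data VertexDecomposable {n : ℕ} : SimplicialComplex n → Set₁ where
  simplex : ∀ {Γ} → IsSimplex Γ → VertexDecomposable Γ
  empty   : ∀ {Γ} → (∀ F → Face Γ F ⇔ F ≡ ⊥) → VertexDecomposable Γ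
  void    : ∀ {Γ} → (∀ F → ¬ Face Γ F) → VertexDecomposable Γ
  shed    : ∀ {Γ} v → IsShedding Γ v →
            VertexDecomposable (del v Γ) → VertexDecomposable (link v Γ) →
            VertexDecomposable Γ

{-# OPTIONS --safe #-}

-- Work with duals relative to a subset S of the ground set, and let v carry the
-- largest label of S.  Deleting v from the dual is dual to linking v in Δ and
-- vice versa; deletion visibly keeps the chordality condition, and so does
-- linking, since f ∪ v and g ∪ v always have the same maximum v.
-- If v were not shedding, some minimal nonface N of Δ avoiding v would have
-- N ∖ x ∪ v ∈ Δ for all x ∈ N; two of these faces have the same size and the
-- same maximum v, so chordality makes N a face.  This needs two elements in N,
-- so elements w of S that are not vertices of Δ are shed first: for them the
-- deletion of w from the dual is the full simplex on S ∖ w.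
--
-- For the converse, the dual of an edge on five points has a triangle as its
-- only minimal nonface; whichever point carries the largest label, some two
-- 3-element faces contain it and cover the triangle.

module Submission where

open import Defs
open import Data.Fin.Base using (Fin; zero; suc; fromℕ) renaming (_≤_ to _≤ᶠ_)
open import Data.Fin.Patterns
open import Data.Fin.Permutation using (_⟨$⟩ʳ_; _⟨$⟩ˡ_; inverseʳ)
open import Data.Bool.Properties using () renaming (_≟_ to _≟ᵇ_)
open import Data.Fin.Properties
  using (≤fromℕ; any?)
  renaming (_≟_ to _≟ᶠ_; all? to ∀?; ≤-refl to ≤ᶠ-refl; ≤-trans to ≤ᶠ-trans; ≤-total to ≤ᶠ-total)
open import Data.Fin.Subset
  using (Subset; Nonempty; inside; outside; ⊤; ⊥; ⁅_⁆; _∈_; _∉_; _⊆_; _⊈_; _∪_; _─_; _-_; ∁; ∣_∣)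
open import Data.Fin.Subset.Properties
open import Data.Nat.Base using (ℕ; suc; _<_; s≤s⁻¹)
open import Data.Nat.Properties using (n<1+n; <-≤-trans; suc-injective; _≟_)
open import Data.Product.Base using (Σ-syntax; ∃-syntax; _×_; _,_; proj₁; proj₂)
open import Data.Sum.Base using (_⊎_; inj₁; inj₂; [_,_]′)
open import Data.Vec.Base using ([]; _∷_; here; there)
open import Data.Vec.Properties using (≡-dec)
open import Function.Base using (_∘_; id)
open import Function.Bundles using (_⇔_; mk⇔; module Equivalence)
open import Function.Construct.Composition using (_⇔-∘_)
open import Function.Construct.Symmetry using (⇔-sym)
open import Relation.Binary.PropositionalEquality
  using (_≡_; _≢_; refl; sym; trans; cong; subst)
open import Relation.Nullary using (¬_; yes; no; contradiction)
open import Relation.Nullary.Decidable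
  using (¬?; _×-dec_; decidable-stable; from-yes)

open Equivalence using (to; from)

private
  variable
    n : ℕ
    p q S F : Subset n
    v x : Fin n
    Γ Γ′ Δ : SimplicialComplex n

-- Differences, insertions and cardinalities of subsets.

x∈p─q⇒x∉q : ∀ (p q : Subset n) → x ∈ p ─ q → x ∉ q
x∈p─q⇒x∉q (_ ∷ p) (inside ∷ q)  (there x∈p─q) (there x∈q) = x∈p─q⇒x∉q p q x∈p─q x∈q
x∈p─q⇒x∉q (_ ∷ p) (outside ∷ q) (there x∈p─q) (there x∈q) = x∈p─q⇒x∉q p q x∈p─q x∈q

x∉p-x : ∀ (p : Subset n) → x ∉ p - x
x∉p-x {x = x} p x∈p-x = x∈p─q⇒x∉q p ⁅ x ⁆ x∈p-x (x∈⁅x⁆ x)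

x∈p⇒⁅x⁆⊆p : x ∈ p → ⁅ x ⁆ ⊆ p
x∈p⇒⁅x⁆⊆p {x = x} x∈p y∈⁅x⁆ with refl ← x∈⁅y⁆⇒x≡y x y∈⁅x⁆ = x∈p

∪-lub : p ⊆ S → q ⊆ S → p ∪ q ⊆ S
∪-lub {p = p} {q = q} p⊆S q⊆S x∈p∪q = [ p⊆S , q⊆S ]′ (x∈p∪q⁻ p q x∈p∪q)

p⊆q∧x∉p⇒p⊆q-x : p ⊆ q → x ∉ p → p ⊆ q - x
p⊆q∧x∉p⇒p⊆q-x p⊆q x∉p y∈p = x∈p∧x≢y⇒x∈p-y (p⊆q y∈p) λ { refl → x∉p y∈p }

p⊆q-x⇒p⊆q : ∀ (q : Subset n) → p ⊆ q - x → p ⊆ q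
p⊆q-x⇒p⊆q {x = x} q p⊆q-x = p─q⊆p q ⁅ x ⁆ ∘ p⊆q-x

p⊆q-x⇒x∉p : ∀ (q : Subset n) → p ⊆ q - x → x ∉ p
p⊆q-x⇒x∉p q p⊆q-x x∈p = x∉p-x q (p⊆q-x x∈p)

x∈p⇒p-x∪⁅x⁆≡p : x ∈ p → (p - x) ∪ ⁅ x ⁆ ≡ p
x∈p⇒p-x∪⁅x⁆≡p {x = x} {p = p} x∈p =
  ⊆-antisym (∪-lub (p─q⊆p p ⁅ x ⁆) (x∈p⇒⁅x⁆⊆p x∈p)) p⊆
  where
  p⊆ : p ⊆ (p - x) ∪ ⁅ x ⁆
  p⊆ {y} y∈p with y ≟ᶠ x
  ... | yes refl = x∈p∪q⁺ (inj₂ (x∈⁅x⁆ x))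
  ... | no y≢x   = x∈p∪q⁺ (inj₁ (x∈p∧x≢y⇒x∈p-y y∈p y≢x))

p-x─q≡p─[q∪⁅x⁆] : ∀ (p q : Subset n) x → p - x ─ q ≡ p ─ (q ∪ ⁅ x ⁆)
p-x─q≡p─[q∪⁅x⁆] p q x =
  trans (p─q─r≡p─q∪r p ⁅ x ⁆ q) (cong (p ─_) (∪-comm ⁅ x ⁆ q))

p-x─q≡p─q-x : ∀ (p q : Subset n) x → p - x ─ q ≡ p ─ q - x
p-x─q≡p─q-x p q x = p─q─r≡p─r─q p ⁅ x ⁆ q

x∉p⇒∣p∪⁅x⁆∣≡1+∣p∣ : ∀ (p : Subset n) {x} → x ∉ p → ∣ p ∪ ⁅ x ⁆ ∣ ≡ suc ∣ p ∣
x∉p⇒∣p∪⁅x⁆∣≡1+∣p∣ (inside  ∷ p) {zero}  x∉p = contradiction here x∉p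
x∉p⇒∣p∪⁅x⁆∣≡1+∣p∣ (outside ∷ p) {zero}  x∉p = cong (suc ∘ ∣_∣) (∪-identityʳ p)
x∉p⇒∣p∪⁅x⁆∣≡1+∣p∣ (inside  ∷ p) {suc x} x∉p =
  cong suc (x∉p⇒∣p∪⁅x⁆∣≡1+∣p∣ p (x∉p ∘ there))
x∉p⇒∣p∪⁅x⁆∣≡1+∣p∣ (outside ∷ p) {suc x} x∉p =
  x∉p⇒∣p∪⁅x⁆∣≡1+∣p∣ p (x∉p ∘ there)

x∈p⇒∣p∣≡1+∣p-x∣ : ∀ (p : Subset n) {x} → x ∈ p → ∣ p ∣ ≡ suc ∣ p - x ∣
x∈p⇒∣p∣≡1+∣p-x∣ p x∈p = trans (cong ∣_∣ (sym (x∈p⇒p-x∪⁅x⁆≡p x∈p)))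
                              (x∉p⇒∣p∪⁅x⁆∣≡1+∣p∣ _ (x∉p-x p))

x∈p∧y∈p⇒∣p-x∣≡∣p-y∣ : ∀ (p : Subset n) {x y} → x ∈ p → y ∈ p → ∣ p - x ∣ ≡ ∣ p - y ∣
x∈p∧y∈p⇒∣p-x∣≡∣p-y∣ p x∈p y∈p =
  suc-injective (trans (sym (x∈p⇒∣p∣≡1+∣p-x∣ p x∈p)) (x∈p⇒∣p∣≡1+∣p-x∣ p y∈p))

p⊆p-x∪p-y : ∀ (p : Subset n) {x y} → x ≢ y → p ⊆ (p - x) ∪ (p - y)
p⊆p-x∪p-y p {x} {y} x≢y {z} z∈p with z ≟ᶠ x
... | yes refl = x∈p∪q⁺ (inj₂ (x∈p∧x≢y⇒x∈p-y z∈p x≢y))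
... | no z≢x   = x∈p∪q⁺ (inj₁ (x∈p∧x≢y⇒x∈p-y z∈p z≢x))

-- An arbitrary `f` replaces the labeling because the recursion passes to `f ∘ suc`, which is no
-- longer a bijection.
∃-maximal : ∀ {m} (f : Fin n → Fin m) (p : Subset n) → Nonempty p →
            ∃[ v ] v ∈ p × (∀ i → i ∈ p → f i ≤ᶠ f v)
∃-maximal f (s ∷ p) p≠∅ with nonempty? p
∃-maximal f (outside ∷ p) (zero  , ())        | no _
∃-maximal f (s       ∷ p) (suc i , there i∈p) | no p=∅ = contradiction (i , i∈p) p=∅
∃-maximal f (inside  ∷ p) (zero  , here)      | no p=∅ = zero , here , λ
  { zero    _           → ≤ᶠ-refl
  ; (suc i) (there i∈p) → contradiction (i , i∈p) p=∅ }
∃-maximal f (s ∷ p) _ | yes p≠∅ with ∃-maximal (f ∘ suc) p p≠∅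
∃-maximal f (outside ∷ p) _ | yes _ | v , v∈p , v-max =
  suc v , there v∈p , λ { (suc i) (there i∈p) → v-max i i∈p }
∃-maximal f (inside ∷ p) _ | yes _ | v , v∈p , v-max with ≤ᶠ-total (f zero) (f (suc v))
... | inj₁ f0≤fv = suc v , there v∈p , λ
  { zero    _           → f0≤fv
  ; (suc i) (there i∈p) → v-max i i∈p }
... | inj₂ fv≤f0 = zero , here , λ
  { zero    _           → ≤ᶠ-refl
  ; (suc i) (there i∈p) → ≤ᶠ-trans (v-max i i∈p) fv≤f0 }

-- Complexes with the same faces.

infix 4 _≃_

-- Equality of records is too strict: the complexes compared below have face predicates that are
-- only logically equivalent, and they carry different decision procedures.
_≃_ : SimplicialComplex n → SimplicialComplex n → Set
Γ ≃ Γ′ = ∀ F → Face Γ F ⇔ Face Γ′ F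

≃-sym : Γ ≃ Γ′ → Γ′ ≃ Γ
≃-sym Γ≃Γ′ F = ⇔-sym (Γ≃Γ′ F)

del-cong : Γ ≃ Γ′ → del v Γ ≃ del v Γ′
del-cong Γ≃Γ′ F = mk⇔ (λ (v∉F , F∈) → v∉F , to (Γ≃Γ′ F) F∈)
                      (λ (v∉F , F∈) → v∉F , from (Γ≃Γ′ F) F∈)

link-cong : Γ ≃ Γ′ → link v Γ ≃ link v Γ′
link-cong Γ≃Γ′ F = mk⇔ (λ (v∉F , F∈) → v∉F , to (Γ≃Γ′ _) F∈)
                       (λ (v∉F , F∈) → v∉F , from (Γ≃Γ′ _) F∈)

IsFacet-resp : Γ ≃ Γ′ → IsFacet Γ F → IsFacet Γ′ F
IsFacet-resp Γ≃Γ′ (F∈Γ , F-max) =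
  to (Γ≃Γ′ _) F∈Γ , λ G G∈Γ′ → F-max G (from (Γ≃Γ′ G) G∈Γ′)

IsShedding-resp : Γ ≃ Γ′ → IsShedding Γ v → IsShedding Γ′ v
IsShedding-resp {Γ = Γ} {Γ′ = Γ′} {v = v} Γ≃Γ′ (v∈Γ , sheds) =
  to (Γ≃Γ′ _) v∈Γ ,
  λ F F-link F-del → sheds F
    (IsFacet-resp {Γ = link v Γ′} {Γ′ = link v Γ}
      (≃-sym {Γ = link v Γ} {Γ′ = link v Γ′} (link-cong {Γ = Γ} {Γ′ = Γ′} Γ≃Γ′)) F-link)
    (IsFacet-resp {Γ = del v Γ′} {Γ′ = del v Γ}
      (≃-sym {Γ = del v Γ} {Γ′ = del v Γ′} (del-cong {Γ = Γ} {Γ′ = Γ′} Γ≃Γ′)) F-del)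

VertexDecomposable-resp : Γ ≃ Γ′ → VertexDecomposable Γ → VertexDecomposable Γ′
VertexDecomposable-resp Γ≃Γ′ (simplex (S , Γ=S)) =
  simplex (S , λ F → Γ=S F ⇔-∘ ⇔-sym (Γ≃Γ′ F))
VertexDecomposable-resp Γ≃Γ′ (empty Γ=∅) = empty λ F → Γ=∅ F ⇔-∘ ⇔-sym (Γ≃Γ′ F)
VertexDecomposable-resp Γ≃Γ′ (void Γ-void) = void λ F → Γ-void F ∘ from (Γ≃Γ′ F)
VertexDecomposable-resp {Γ = Γ} {Γ′ = Γ′} Γ≃Γ′ (shed v sheds del-vd link-vd) =
  shed v (IsShedding-resp {Γ = Γ} {Γ′ = Γ′} Γ≃Γ′ sheds)
    (VertexDecomposable-resp (del-cong {Γ = Γ} {Γ′ = Γ′} Γ≃Γ′) del-vd)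
    (VertexDecomposable-resp (link-cong {Γ = Γ} {Γ′ = Γ′} Γ≃Γ′) link-vd)

-- Alexander duals of restrictions to `S`, all kept on the ground set `Fin n`.

dualOn : Subset n → SimplicialComplex n → SimplicialComplex n
Face        (dualOn S Δ) F = F ⊆ S × ¬ Face Δ (S ─ F)
face?       (dualOn S Δ) F = (F ⊆? S) ×-dec ¬? (face? Δ (S ─ F))
down-closed (dualOn S Δ) {F} {G} G⊆F (F⊆S , S─F∉Δ) =
  F⊆S ∘ G⊆F , λ S─G∈Δ → S─F∉Δ (down-closed Δ S─F⊆S─G S─G∈Δ)
  where
  S─F⊆S─G : S ─ F ⊆ S ─ G
  S─F⊆S─G x∈S─F =
    x∈p∧x∉q⇒x∈p─q (p─q⊆p S F x∈S─F) (x∈p─q⇒x∉q S F x∈S─F ∘ G⊆F)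

dualOn-⊤ : (Δ : SimplicialComplex n) → dualOn ⊤ Δ ≃ Δ ᵛ
dualOn-⊤ Δ F = mk⇔ to-dual from-dual
  where
  to-dual : Face (dualOn ⊤ Δ) F → Face (Δ ᵛ) F
  to-dual (_ , ⊤─F∉Δ) ∁F∈Δ = ⊤─F∉Δ
    (down-closed Δ (λ x∈ → x∉p⇒x∈∁p (x∈p─q⇒x∉q ⊤ F x∈)) ∁F∈Δ)

  from-dual : Face (Δ ᵛ) F → Face (dualOn ⊤ Δ) F
  from-dual ∁F∉Δ = (λ _ → ∈⊤) , λ ⊤─F∈Δ → ∁F∉Δ
    (down-closed Δ (λ x∈ → x∈p∧x∉q⇒x∈p─q ∈⊤ (x∈∁p⇒x∉p x∈)) ⊤─F∈Δ)

-- Removing `v` from `S` and adding `v` to `F` have the same effect on the complement of `F` in `S`.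
link-dualOn : ∀ (S : Subset n) {v} (Δ : SimplicialComplex n) → v ∈ S →
              dualOn (S - v) Δ ≃ link v (dualOn S Δ)
link-dualOn S {v} Δ v∈S F = mk⇔ from-dual to-dual
  where
  to-dual : Face (link v (dualOn S Δ)) F → Face (dualOn (S - v) Δ) F
  to-dual (v∉F , Fv⊆S , N∉Δ) =
    p⊆q∧x∉p⇒p⊆q-x (λ x∈F → Fv⊆S (p⊆p∪q ⁅ v ⁆ x∈F)) v∉F ,
    N∉Δ ∘ subst (Face Δ) (p-x─q≡p─[q∪⁅x⁆] S F v)

  from-dual : Face (dualOn (S - v) Δ) F → Face (link v (dualOn S Δ)) F
  from-dual (F⊆S-v , N∉Δ) =
    p⊆q-x⇒x∉p S F⊆S-v ,
    ∪-lub (p⊆q-x⇒p⊆q S F⊆S-v) (x∈p⇒⁅x⁆⊆p v∈S) ,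
    N∉Δ ∘ subst (Face Δ) (sym (p-x─q≡p─[q∪⁅x⁆] S F v))

-- When `F` avoids `v`, its complement in `S` is its complement in `S - v` with `v` adjoined.
del-dualOn : ∀ (S : Subset n) {v} (Δ : SimplicialComplex n) → v ∈ S →
             dualOn (S - v) (link v Δ) ≃ del v (dualOn S Δ)
del-dualOn S {v} Δ v∈S F = mk⇔ from-dual to-dual
  where
  N∪v≡S─F : v ∉ F → (S - v ─ F) ∪ ⁅ v ⁆ ≡ S ─ F
  N∪v≡S─F v∉F = trans (cong (_∪ ⁅ v ⁆) (p-x─q≡p─q-x S F v))
                      (x∈p⇒p-x∪⁅x⁆≡p (x∈p∧x∉q⇒x∈p─q v∈S v∉F))

  to-dual : Face (del v (dualOn S Δ)) F → Face (dualOn (S - v) (link v Δ)) F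
  to-dual (v∉F , F⊆S , S─F∉Δ) =
    p⊆q∧x∉p⇒p⊆q-x F⊆S v∉F ,
    λ (_ , Nv∈Δ) → S─F∉Δ (subst (Face Δ) (N∪v≡S─F v∉F) Nv∈Δ)

  from-dual : Face (dualOn (S - v) (link v Δ)) F → Face (del v (dualOn S Δ)) F
  from-dual (F⊆S-v , N∉link) =
    v∉F , p⊆q-x⇒p⊆q S F⊆S-v , λ S─F∈Δ → N∉link
      ( subst (v ∉_) (sym (p-x─q≡p─q-x S F v)) (x∉p-x (S ─ F))
      , subst (Face Δ) (sym (N∪v≡S─F v∉F)) S─F∈Δ)
    where
    v∉F : v ∉ F
    v∉F = p⊆q-x⇒x∉p S F⊆S-v

isSimplex : (Γ : SimplicialComplex n) (S : Subset n) →
            (∀ F → Face Γ F → F ⊆ S) → (∀ F → F ⊆ S → Face Γ F) → IsSimplex Γ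
isSimplex Γ S faces⊆S ⊆S⇒face = S , λ F → mk⇔ (faces⊆S F) (⊆S⇒face F)

dualOn-void : ∀ (S : Subset n) (Δ : SimplicialComplex n) → ¬ Face Δ ⊥ →
              IsSimplex (dualOn S Δ)
dualOn-void S Δ ⊥∉Δ = isSimplex (dualOn S Δ) S
  (λ _ (F⊆S , _) → F⊆S) (λ _ F⊆S → F⊆S , ⊥∉Δ ∘ down-closed Δ ⊥⊆)

-- Points of `S` that are not vertices of `Δ`.

∃-nonvertex? : (S : Subset n) (Δ : SimplicialComplex n) →
  (∃[ w ] w ∈ S × ¬ IsVertex Δ w) ⊎ (∀ x → x ∈ S → IsVertex Δ x)
∃-nonvertex? S Δ with any? (λ w → (w ∈? S) ×-dec ¬? (face? Δ ⁅ w ⁆))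
... | yes ∃w = inj₁ ∃w
... | no ∄w  = inj₂ λ x x∈S →
  decidable-stable (face? Δ ⁅ x ⁆) λ x∉Δ → ∄w (x , x∈S , x∉Δ)

module NonVertex (S : Subset n) {w : Fin n} (Δ : SimplicialComplex n)
                 (w∈S : w ∈ S) (w∉Δ : ¬ IsVertex Δ w) where

  -- The complement of `F` in `S` contains `w`, and no face of `Δ` does.
  dualOn-face : F ⊆ S → w ∉ F → Face (dualOn S Δ) F
  dualOn-face F⊆S w∉F =
    F⊆S , w∉Δ ∘ down-closed Δ (x∈p⇒⁅x⁆⊆p (x∈p∧x∉q⇒x∈p─q w∈S w∉F))

  del-simplex : IsSimplex (del w (dualOn S Δ))
  del-simplex = isSimplex (del w (dualOn S Δ)) (S - w)
    (λ _ (w∉F , F⊆S , _) → p⊆q∧x∉p⇒p⊆q-x F⊆S w∉F)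
    (λ _ F⊆S-w → p⊆q-x⇒x∉p S F⊆S-w ,
                 dualOn-face (p⊆q-x⇒p⊆q S F⊆S-w) (p⊆q-x⇒x∉p S F⊆S-w))

  -- The deletion of `w` is the full simplex on `S - w`, so its only facet is `S - w`. Were this in
  -- the link, the complement of `S` in itself would be a nonface of `Δ`, against `⊥` being a face.
  shedding : Face Δ ⊥ → IsVertex (dualOn S Δ) w → IsShedding (dualOn S Δ) w
  shedding ⊥∈Δ w∈D = w∈D , λ
    { F ((_ , _ , N∉Δ) , _) ((w∉F , F⊆S , _) , F-max) →
      let F≡S-w = F-max (S - w)
                    (from (proj₂ del-simplex (S - w)) id)
                    (p⊆q∧x∉p⇒p⊆q-x F⊆S w∉F)
      in N∉Δ (down-closed Δ (λ x∈N → contradiction x∈N (N-empty F≡S-w)) ⊥∈Δ) }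
    where
    N-empty : F ≡ S - w → x ∉ S ─ (F ∪ ⁅ w ⁆)
    N-empty refl x∈N = x∈p─q⇒x∉q S _ x∈N
      (subst (_ ∈_) (sym (x∈p⇒p-x∪⁅x⁆≡p w∈S)) (p─q⊆p S _ x∈N))

-- A shedding vertex must be a vertex of the dual. If the chosen point is not one, decomposability
-- of the deletion already settles the whole complex.
del-nonvertex : ∀ (v : Fin n) (Γ : SimplicialComplex n) → ¬ IsVertex Γ v → del v Γ ≃ Γ
del-nonvertex v Γ v∉Γ F =
  mk⇔ proj₂ (λ F∈Γ → (λ v∈F → v∉Γ (down-closed Γ (x∈p⇒⁅x⁆⊆p v∈F) F∈Γ)) , F∈Γ)

-- Chordality on a subset and its point of largest label.

ChordalOn : VertexLabeling n → Subset n → SimplicialComplex n → Set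
ChordalOn ℓ S Δ =
  ∀ f g → f ⊆ S → g ⊆ S → Face Δ f → Face Δ g → f ≢ g → ∣ f ∣ ≡ ∣ g ∣ →
  SameMax ℓ f g → ∀ h → h ⊆ f ∪ g → ∣ h ∣ ≡ ∣ f ∣ → Face Δ h

ChordalOn-⊆ : ∀ ℓ → p ⊆ q → ChordalOn ℓ q Δ → ChordalOn ℓ p Δ
ChordalOn-⊆ ℓ p⊆q chordal f g f⊆p g⊆p =
  chordal f g (λ x∈f → p⊆q (f⊆p x∈f)) (λ x∈g → p⊆q (g⊆p x∈g))

module MaximalLabel (ℓ : VertexLabeling n) (S : Subset n) {v : Fin n}
                    (Δ : SimplicialComplex n) (chordal : ChordalOn ℓ S Δ)
                    (v∈S : v ∈ S) (v-max : ∀ i → i ∈ S → (ℓ ⟨$⟩ʳ i) ≤ᶠ (ℓ ⟨$⟩ʳ v)) where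

  isMaxLabel : p ⊆ S → v ∈ p → IsMaxLabel ℓ p (ℓ ⟨$⟩ʳ v)
  isMaxLabel p⊆S v∈p = (v , v∈p , refl) , λ i i∈p → v-max i (p⊆S i∈p)

  -- Adjoining `v` to `f`, `g` and `h` raises each size by one, keeps `f` and `g` distinct and gives
  -- both the same maximum, so chordality on `S` applies.
  link-chordal : ChordalOn ℓ (S - v) (link v Δ)
  link-chordal f g f⊆S-v g⊆S-v (v∉f , fv∈Δ) (v∉g , gv∈Δ) f≢g ∣f∣≡∣g∣ _ h h⊆f∪g ∣h∣≡∣f∣ =
    v∉h ,
    chordal (f ∪ ⁅ v ⁆) (g ∪ ⁅ v ⁆) fv⊆S gv⊆S fv∈Δ gv∈Δ
      (f≢g ∘ fv≡gv⇒f≡g)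
      (trans (x∉p⇒∣p∪⁅x⁆∣≡1+∣p∣ f v∉f)
        (trans (cong suc ∣f∣≡∣g∣) (sym (x∉p⇒∣p∪⁅x⁆∣≡1+∣p∣ g v∉g))))
      (ℓ ⟨$⟩ʳ v , isMaxLabel fv⊆S (v∈∪ f) , isMaxLabel gv⊆S (v∈∪ g))
      (h ∪ ⁅ v ⁆) hv⊆
      (trans (x∉p⇒∣p∪⁅x⁆∣≡1+∣p∣ h v∉h)
        (trans (cong suc ∣h∣≡∣f∣) (sym (x∉p⇒∣p∪⁅x⁆∣≡1+∣p∣ f v∉f))))
    where
    v∈∪ : ∀ p → v ∈ p ∪ ⁅ v ⁆
    v∈∪ p = q⊆p∪q p ⁅ v ⁆ (x∈⁅x⁆ v)

    fv⊆S : f ∪ ⁅ v ⁆ ⊆ S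
    fv⊆S = ∪-lub (p⊆q-x⇒p⊆q S f⊆S-v) (x∈p⇒⁅x⁆⊆p v∈S)

    gv⊆S : g ∪ ⁅ v ⁆ ⊆ S
    gv⊆S = ∪-lub (p⊆q-x⇒p⊆q S g⊆S-v) (x∈p⇒⁅x⁆⊆p v∈S)

    v∉h : v ∉ h
    v∉h v∈h = [ v∉f , v∉g ]′ (x∈p∪q⁻ f g (h⊆f∪g v∈h))

    hv⊆ : h ∪ ⁅ v ⁆ ⊆ (f ∪ ⁅ v ⁆) ∪ (g ∪ ⁅ v ⁆)
    hv⊆ = ∪-lub
      (λ x∈h → [ x∈p∪q⁺ ∘ inj₁ ∘ p⊆p∪q ⁅ v ⁆ , x∈p∪q⁺ ∘ inj₂ ∘ p⊆p∪q ⁅ v ⁆ ]′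
        (x∈p∪q⁻ f g (h⊆f∪g x∈h)))
      (x∈p∪q⁺ ∘ inj₁ ∘ q⊆p∪q f ⁅ v ⁆)

    pv≡qv⇒p⊆q : ∀ {p} q → v ∉ p → p ∪ ⁅ v ⁆ ≡ q ∪ ⁅ v ⁆ → p ⊆ q
    pv≡qv⇒p⊆q q v∉p pv≡qv x∈p
      with x∈p∪q⁻ q ⁅ v ⁆ (subst (_ ∈_) pv≡qv (p⊆p∪q ⁅ v ⁆ x∈p))
    ... | inj₁ x∈q = x∈q
    ... | inj₂ x∈v with refl ← x∈⁅y⁆⇒x≡y v x∈v = contradiction x∈p v∉p

    fv≡gv⇒f≡g : f ∪ ⁅ v ⁆ ≡ g ∪ ⁅ v ⁆ → f ≡ g
    fv≡gv⇒f≡g eq = ⊆-antisym (pv≡qv⇒p⊆q g v∉f eq) (pv≡qv⇒p⊆q f v∉g (sym eq))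

  -- For `F` in the link, `N = S - v ─ F` is a nonface of `Δ`. It is not empty because `⊥` is a
  -- face, and not a singleton because every point of `S` is a vertex; two points of `N` feed the
  -- chordality condition.
  shedding : Face Δ ⊥ → (∀ x → x ∈ S → IsVertex Δ x) →
             IsVertex (dualOn S Δ) v → IsShedding (dualOn S Δ) v
  shedding ⊥∈Δ vertices v∈D = v∈D , λ
    { F F-link F-del → not-both F (proj₁ F-link) F-del }
    where
    not-both : ∀ F → Face (link v (dualOn S Δ)) F → ¬ IsFacet (del v (dualOn S Δ)) F
    not-both F F∈link ((v∉F , F⊆S , _) , F-max) with nonempty? (S - v ─ F)
    ... | no N=∅ = proj₂ (from (link-dualOn S Δ v∈S F) F∈link)
                     (subst (Face Δ) (sym (Empty-unique N=∅)) ⊥∈Δ)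
    ... | yes (x , x∈N′) with nonempty? (S - v ─ F - x)
    ... | no N-x=∅ = proj₂ (from (link-dualOn S Δ v∈S F) F∈link)
                       (down-closed Δ N⊆⁅x⁆ (vertices x (p─q⊆p S _ (p─q⊆p _ F x∈N′))))
      where
      N⊆⁅x⁆ : S - v ─ F ⊆ ⁅ x ⁆
      N⊆⁅x⁆ {y} y∈N with y ≟ᶠ x
      ... | yes refl = x∈⁅x⁆ x
      ... | no y≢x   = contradiction (y , x∈p∧x≢y⇒x∈p-y y∈N y≢x) N-x=∅
    -- Here `h` is `M - v`, which is the nonface `N`: `M - x` and `M - y` cover `M` since `x ≢ y`,
    -- and all three sets omit exactly one point of `M`.
    ... | yes (y , y∈N-x) = N∉Δ
      (chordal (M - x) (M - y) (p─q⊆p S F ∘ p─q⊆p M _) (p─q⊆p S F ∘ p─q⊆p M _)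
        (M-z∈Δ x∈N) (M-z∈Δ y∈N)
        M-x≢M-y
        (x∈p∧y∈p⇒∣p-x∣≡∣p-y∣ M (p─q⊆p M _ x∈N) (p─q⊆p M _ y∈N))
        (ℓ ⟨$⟩ʳ v ,
          isMaxLabel (p─q⊆p S F ∘ p─q⊆p M _) (v∈M-z x∈N) ,
          isMaxLabel (p─q⊆p S F ∘ p─q⊆p M _) (v∈M-z y∈N))
        (M - v) (p⊆p-x∪p-y M x≢y ∘ p─q⊆p M _)
        (x∈p∧y∈p⇒∣p-x∣≡∣p-y∣ M v∈M (p─q⊆p M _ x∈N)))
      where
      -- M = N ∪ v, so the faces M - z below are the N ∖ z ∪ v of the header.
      M : Subset _
      M = S ─ F

      N≡M-v : S - v ─ F ≡ M - v
      N≡M-v = p-x─q≡p─q-x S F v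

      N∉Δ : ¬ Face Δ (M - v)
      N∉Δ = subst (λ N → ¬ Face Δ N) N≡M-v (proj₂ (from (link-dualOn S Δ v∈S F) F∈link))

      v∈M : v ∈ M
      v∈M = x∈p∧x∉q⇒x∈p─q v∈S v∉F

      x∈N : x ∈ M - v
      x∈N = subst (x ∈_) N≡M-v x∈N′

      y∈N : y ∈ M - v
      y∈N = subst (y ∈_) N≡M-v (p─q⊆p _ ⁅ x ⁆ y∈N-x)

      x≢y : x ≢ y
      x≢y refl = x∉p-x (S - v ─ F) y∈N-x

      v∈M-z : ∀ {z} → z ∈ M - v → v ∈ M - z
      v∈M-z z∈N = x∈p∧x≢y⇒x∈p-y v∈M λ { refl → x∉p-x M z∈N }

      M-x≢M-y : M - x ≢ M - y
      M-x≢M-y eq =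
        x∉p-x M (subst (x ∈_) (sym eq) (x∈p∧x≢y⇒x∈p-y (p─q⊆p M _ x∈N) x≢y))

      -- By maximality of `F` in the deletion, `F ∪ ⁅ z ⁆` is not a face of the dual, so its
      -- complement `M - z` in `S` is a face of `Δ`.
      M-z∈Δ : ∀ {z} → z ∈ M - v → Face Δ (M - z)
      M-z∈Δ {z} z∈N = decidable-stable (face? Δ _) λ M-z∉Δ →
        let F≡Fz = F-max (F ∪ ⁅ z ⁆) (Fz∈del M-z∉Δ) (p⊆p∪q ⁅ z ⁆)
        in x∈p─q⇒x∉q S F z∈M (subst (z ∈_) (sym F≡Fz) (q⊆p∪q F ⁅ z ⁆ (x∈⁅x⁆ z)))
        where
        z∈M : z ∈ M
        z∈M = p─q⊆p M ⁅ v ⁆ z∈N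

        S─Fz≡M-z : S ─ (F ∪ ⁅ z ⁆) ≡ M - z
        S─Fz≡M-z = sym (p─q─r≡p─q∪r S F ⁅ z ⁆)

        v∉Fz : v ∉ F ∪ ⁅ z ⁆
        v∉Fz v∈Fz with x∈p∪q⁻ F ⁅ z ⁆ v∈Fz
        ... | inj₁ v∈F = v∉F v∈F
        ... | inj₂ v∈z with refl ← x∈⁅y⁆⇒x≡y z v∈z = x∉p-x M z∈N

        Fz∈del : ¬ Face Δ (M - z) → Face (del v (dualOn S Δ)) (F ∪ ⁅ z ⁆)
        Fz∈del M-z∉Δ =
          v∉Fz , ∪-lub F⊆S (x∈p⇒⁅x⁆⊆p (p─q⊆p S F z∈M)) ,
          M-z∉Δ ∘ subst (Face Δ) S─Fz≡M-z

-- The bound `k` serves termination, as `S - v` is smaller only in cardinality. One labeling works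
-- throughout, since chordality passes to subsets of `S` and to links at the point of largest label.
dualOn-vertexDecomposable :
  ∀ ℓ k (S : Subset n) (Δ : SimplicialComplex n) → ∣ S ∣ < k →
  ChordalOn ℓ S Δ → VertexDecomposable (dualOn S Δ)
dualOn-vertexDecomposable ℓ (suc k) S Δ ∣S∣<1+k chordal
  with face? Δ ⊥ | nonempty? S | ∃-nonvertex? S Δ
... | no ⊥∉Δ  | _ | _ = simplex (dualOn-void S Δ ⊥∉Δ)
... | yes ⊥∈Δ | no S=∅ | _ =
  void λ F (_ , S─F∉Δ) →
    S─F∉Δ (down-closed Δ (λ x∈ → contradiction (_ , p─q⊆p S F x∈) S=∅) ⊥∈Δ)
... | yes ⊥∈Δ | yes _ | inj₁ (w , w∈S , w∉Δ) with face? (dualOn S Δ) ⁅ w ⁆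
...   | no w∉D  = VertexDecomposable-resp {Γ = del w (dualOn S Δ)}
  (del-nonvertex w (dualOn S Δ) w∉D) (simplex (NonVertex.del-simplex S Δ w∈S w∉Δ))
...   | yes w∈D = shed w (NonVertex.shedding S Δ w∈S w∉Δ ⊥∈Δ w∈D)
  (simplex (NonVertex.del-simplex S Δ w∈S w∉Δ))
  (VertexDecomposable-resp (link-dualOn S Δ w∈S)
    (dualOn-vertexDecomposable ℓ k (S - w) Δ
      (<-≤-trans (x∈p⇒∣p-x∣<∣p∣ w∈S) (s≤s⁻¹ ∣S∣<1+k))
      (ChordalOn-⊆ {Δ = Δ} ℓ (p─q⊆p S ⁅ w ⁆) chordal)))
dualOn-vertexDecomposable ℓ (suc k) S Δ ∣S∣<1+k chordal
    | yes ⊥∈Δ | yes S≠∅ | inj₂ vertices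
  with v , v∈S , v-max ← ∃-maximal (ℓ ⟨$⟩ʳ_) S S≠∅
  -- The complex stays a parameter: `link v Δ` is needed for the deletion and `Δ` itself for the
  -- link.
  with IH ← (λ Δ′ → dualOn-vertexDecomposable ℓ k (S - v) Δ′
                      (<-≤-trans (x∈p⇒∣p-x∣<∣p∣ v∈S) (s≤s⁻¹ ∣S∣<1+k)))
  with del-vd ← VertexDecomposable-resp (del-dualOn S Δ v∈S)
         (IH (link v Δ) (MaximalLabel.link-chordal ℓ S Δ chordal v∈S v-max))
  with face? (dualOn S Δ) ⁅ v ⁆
... | no v∉D  = VertexDecomposable-resp (del-nonvertex v (dualOn S Δ) v∉D) del-vd
... | yes v∈D =
  shed v (MaximalLabel.shedding ℓ S Δ chordal v∈S v-max ⊥∈Δ vertices v∈D) del-vd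
    (VertexDecomposable-resp (link-dualOn S Δ v∈S)
      (IH Δ (ChordalOn-⊆ {Δ = Δ} ℓ (p─q⊆p S ⁅ v ⁆) chordal)))

dual-vertexDecomposable : (Δ : SimplicialComplex n) →
                          SkeletonEChordal Δ → VertexDecomposable (Δ ᵛ)
dual-vertexDecomposable Δ (ℓ , chordal) =
  VertexDecomposable-resp (dualOn-⊤ Δ)
    (dualOn-vertexDecomposable ℓ _ ⊤ Δ (n<1+n _) λ f g _ _ → chordal f g)

-- The counterexample: complexes with a single minimal nonface `W`.

avoiding : Subset n → SimplicialComplex n
Face        (avoiding W) F = W ⊈ F
face?       (avoiding W) F = ¬? (W ⊆? F)
down-closed (avoiding W) G⊆F W⊈F W⊆G = W⊈F (λ x∈W → G⊆F (W⊆G x∈W))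

-- The complement of `F` contains `W` exactly when `F` misses `W`. The double negation disappears
-- because missing `W` is itself a negative statement.
avoiding-dual : ∀ (W F : Subset n) → Face (avoiding W ᵛ) F ⇔ F ⊆ ∁ W
avoiding-dual W F = mk⇔ to-⊆ from-⊆
  where
  to-⊆ : Face (avoiding W ᵛ) F → F ⊆ ∁ W
  to-⊆ ¬W⊈∁F x∈F = x∉p⇒x∈∁p λ x∈W → ¬W⊈∁F λ W⊆∁F → x∈∁p⇒x∉p (W⊆∁F x∈W) x∈F

  from-⊆ : F ⊆ ∁ W → Face (avoiding W ᵛ) F
  from-⊆ F⊆∁W W⊈∁F = W⊈∁F λ x∈W → x∉p⇒x∈∁p λ x∈F → x∈∁p⇒x∉p (F⊆∁W x∈F) x∈W

triangle : Subset 5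
triangle = outside ∷ outside ∷ inside ∷ inside ∷ inside ∷ []

-- Two faces through the point t of largest label that cover W = triangle:
-- for t outside W take W ∖ x ∪ t and W ∖ y ∪ t; for t in W take
-- W ∖ x ∪ a and W ∖ y ∪ a with x, y ≠ t and a outside W.
witness₁ witness₂ : Fin 5 → Subset 5
witness₁ 0F = inside ∷ outside ∷ inside ∷ inside ∷ outside ∷ []
witness₁ 1F = outside ∷ inside ∷ inside ∷ inside ∷ outside ∷ []
witness₁ 2F = inside ∷ outside ∷ inside ∷ inside ∷ outside ∷ []
witness₁ 3F = inside ∷ outside ∷ inside ∷ inside ∷ outside ∷ []
witness₁ 4F = inside ∷ outside ∷ inside ∷ outside ∷ inside ∷ []
witness₂ 0F = inside ∷ outside ∷ inside ∷ outside ∷ inside ∷ []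
witness₂ 1F = outside ∷ inside ∷ inside ∷ outside ∷ inside ∷ []
witness₂ 2F = inside ∷ outside ∷ inside ∷ outside ∷ inside ∷ []
witness₂ 3F = inside ∷ outside ∷ outside ∷ inside ∷ inside ∷ []
witness₂ 4F = inside ∷ outside ∷ outside ∷ inside ∷ inside ∷ []

avoiding-triangle-not-chordal : ¬ SkeletonEChordal (avoiding triangle)
avoiding-triangle-not-chordal (ℓ , chordal) =
  chordal (witness₁ t) (witness₂ t)
    -- The value of `t` is unknown, so each side condition is decided for all five points and then
    -- specialised.
    (from-yes (∀? λ t → ¬? (triangle ⊆? witness₁ t)) t)
    (from-yes (∀? λ t → ¬? (triangle ⊆? witness₂ t)) t)
    (from-yes (∀? λ t → ¬? (≡-dec _≟ᵇ_ (witness₁ t) (witness₂ t))) t)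
    (from-yes (∀? λ t → ∣ witness₁ t ∣ ≟ ∣ witness₂ t ∣) t)
    (fromℕ 4 ,
      isMaxLabel (from-yes (∀? λ t → t ∈? witness₁ t) t) ,
      isMaxLabel (from-yes (∀? λ t → t ∈? witness₂ t) t))
    triangle
    (from-yes (∀? λ t → triangle ⊆? witness₁ t ∪ witness₂ t) t)
    (from-yes (∀? λ t → ∣ triangle ∣ ≟ ∣ witness₁ t ∣) t)
    -- Chordality would yield `triangle ⊈ triangle`, which reflexivity refutes.
    id
  where
  -- This point carries the largest of the five labels, hence is maximal in every set containing it.
  t : Fin 5
  t = ℓ ⟨$⟩ˡ fromℕ 4

  isMaxLabel : t ∈ p → IsMaxLabel ℓ p (fromℕ 4)
  isMaxLabel t∈p = (t , t∈p , inverseʳ ℓ) , λ i _ → ≤fromℕ (ℓ ⟨$⟩ʳ i)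

theorem126 : (∀ (n : ℕ) (Δ : SimplicialComplex n) →
    SkeletonEChordal Δ → VertexDecomposable (Δ ᵛ))
    ×
    (∃[ n ] Σ[ Δ ∈ SimplicialComplex n ]
    (∀ i → IsVertex Δ i) ×
    HasDimension (Δ ᵛ) 1 ×
    VertexDecomposable (Δ ᵛ) ×
    ¬ SkeletonEChordal Δ)
theorem126 =
  (λ n → dual-vertexDecomposable) ,
  5 , avoiding triangle ,
  from-yes (∀? λ i → face? (avoiding triangle) ⁅ i ⁆) ,
  -- The dual is the full simplex on the two points of `∁ triangle`, which gives both its dimension
  -- and its decomposability.
  ((∁ triangle , from (avoiding-dual triangle _) id , refl) ,
    λ F F∈ → p⊆q⇒∣p∣≤∣q∣ (to (avoiding-dual triangle F) F∈)) ,
  simplex (∁ triangle , avoiding-dual triangle) ,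
  avoiding-triangle-not-chordal
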